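{- For every multi-clause-set $F$: $\sigma(F) = \delta(F)$ holds if and only if for all $v \in \mathrm{var}(F)$ the multi-clause-set $F^{\mathrm{var}(F) \setminus \{v\}}$ is matching-satisfiable.
   Context: Literals come with a fixed-point-free involution $x \mapsto \overline{x}$; variables are positive literals. A clause is a finite set $C$ of literals with $C \cap \overline{C} = \emptyset$. A multi-clause-set is a map $F$ from clauses to $\mathbb{N}_0$ with only finitely many clauses of nonzero multiplicity; $G \le F$ means $G(C) \le F(C)$ for all clauses $C$. $\mathrm{var}(F)$ is the set of variables occurring in clauses of nonzero multiplicity, $n(F) = |\mathrm{var}(F)|$, $c(F) = \sum_C F(C)$, $\delta(F) = c(F) - n(F)$. Surplus: $\sigma(F) = \min_{\emptyset \ne V \subseteq \mathrm{var}(F)} \big(\sum_{C : \mathrm{var}(C) \cap V \ne \emptyset} F(C) - |V|\big)$ if $n(F) > 0$, and $\sigma(F) = 0$ if $n(F) = 0$. For a set $V$ of variables, $F^V$ is the multi-clause-set with $F^V(C) = F(C)$ if $\mathrm{var}(C) \subseteq V$ and $F^V(C) = 0$ otherwise. A multi-clause-set $G$ is matching-satisfiable iff $\delta(G') \le 0$ for every $G' \le G$.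
   Formalization: Assumes that a multi-clause-set F without variables has no clauses: for copies of the empty clause alone σ(F) = 0 < δ(F) while the right side holds vacuously; equality of literals is taken to be decidable, which excluded middle supplies. -}

module Defs where

open import Level using (Level) renaming (suc to lsuc)
open import Data.Bool using (Bool; true; false; not; T; if_then_else_)
open import Data.Bool.Properties using (T-irrelevant)
open import Data.Empty using (⊥-elim)
open import Data.Integer using (ℤ; +_; _-_)
import Data.Integer as ℤ
import Data.Integer.Properties as ℤₚ
open import Data.List using (List; []; _∷_; map; filter; concatMap; deduplicate; length; _++_; [_])
import Data.List.Extrema ℤₚ.≤-totalOrder as Extremaℤ
import Data.List.Membership.DecPropositional as DecMembership
import Data.List.Membership.Setoid as SetoidMembership
import Data.List.Relation.Binary.Subset.DecPropositional as DecSubset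
open import Data.List.Membership.Propositional using (_∈_)
import Data.List.Membership.Setoid.Properties as SetoidMembershipₚ
open import Data.List.Relation.Binary.Disjoint.Propositional using (Disjoint)
open import Data.List.Relation.Binary.Subset.Propositional using (_⊆_)
open import Data.List.Relation.Binary.Subset.Propositional.Properties using (⊆-refl; ⊆-trans; map⁺)
open import Data.List.Relation.Unary.All using ([])
open import Data.List.Relation.Unary.AllPairs using ([]; _∷_)
open import Data.List.Relation.Unary.Any using (Any; any?; here; there)
import Data.List.Relation.Unary.Unique.Setoid as UniqueSetoid
import Data.List.Relation.Unary.Unique.Setoid.Properties as UniqueSetoidₚ
open import Data.Nat using (ℕ; _≤_)
open import Data.Nat.ListAction using (sum)
open import Data.Product using (_×_; _,_; proj₁; proj₂; Σ)
open import Data.Product.Properties using (≡-dec)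
open import Function using (_⇔_; Equivalence)
open import Relation.Binary using (Setoid; DecidableEquality)
open import Relation.Binary.PropositionalEquality using (_≡_; _≢_; refl; sym; subst)
open import Relation.Nullary using (¬_; Dec; yes; no; does; ¬?)
open import Relation.Nullary.Decidable using (T?)

record Literals (ℓ : Level) : Set (lsuc ℓ) where
  field
    Lit                 : Set ℓ
    _≟_                 : DecidableEquality Lit
    bar                 : Lit → Lit
    bar-involutive      : ∀ x → bar (bar x) ≡ x
    bar-fixedPointFree  : ∀ x → bar x ≢ x
    positive            : Lit → Bool
    -- Exactly one literal of each complementary pair is a variable.
    positive-bar        : ∀ x → positive (bar x) ≡ not (positive x)

-- On a duplicate-free list: its nonempty subsets, each listed exactly once.
nonemptySublists : ∀ {a} {A : Set a} → List A → List (List A)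
nonemptySublists []       = []
nonemptySublists (x ∷ xs) =
  [ x ] ∷ map (x ∷_) (nonemptySublists xs) ++ nonemptySublists xs

module ClauseSets {ℓ : Level} (L : Literals ℓ) where
  open Literals L

  Var : Set ℓ
  Var = Σ Lit (λ x → T (positive x))

  _≟ᵛ_ : DecidableEquality Var
  _≟ᵛ_ = ≡-dec _≟_ (λ p q → yes (T-irrelevant p q))

  open DecMembership _≟ᵛ_ using (_∈?_)
  open DecSubset _≟ᵛ_ using (_⊆?_)

  varOf : Lit → Var
  varOf x with T? (positive x)
  ... | yes p = x , p
  ... | no ¬p = bar x , subst T (sym (positive-bar x)) (lemma (positive x) ¬p)
    where
    lemma : ∀ b → ¬ T b → T (not b)
    lemma true  ¬t = ⊥-elim (¬t _)
    lemma false _  = _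

  -- A finite set is a list, considered up to mutual inclusion.
  record Clause : Set ℓ where
    field
      literals   : List Lit
      consistent : Disjoint literals (map bar literals)
  open Clause public

  _≈_ : Clause → Clause → Set ℓ
  C ≈ D = literals C ⊆ literals D × literals D ⊆ literals C

  clauseSetoid : Setoid ℓ ℓ
  clauseSetoid = record
    { Carrier       = Clause
    ; _≈_           = _≈_
    ; isEquivalence = record
      { refl  = ⊆-refl , ⊆-refl
      ; sym   = λ (p , q) → q , p
      ; trans = λ (p , q) (p′ , q′) → ⊆-trans p p′ , ⊆-trans q′ q
      }
    }

  open SetoidMembership clauseSetoid using () renaming (_∈_ to _∈ᶜ_)
  open UniqueSetoid clauseSetoid using (Unique)

  vars : Clause → List Var
  vars C = map varOf (literals C)

  -- `support` enumerates without repetition (up to _≈_) exactly the clauses of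
  -- nonzero multiplicity, so sums over all clauses are sums over `support`.
  record MultiClauseSet : Set ℓ where
    field
      mult             : Clause → ℕ
      mult-cong        : ∀ {C D} → C ≈ D → mult C ≡ mult D
      support          : List Clause
      support-unique   : Unique support
      support-nonzero  : ∀ {C} → C ∈ᶜ support → mult C ≢ 0
      support-complete : ∀ {C} → mult C ≢ 0 → C ∈ᶜ support
  open MultiClauseSet public

  infix 4 _≤ᶠ_
  _≤ᶠ_ : MultiClauseSet → MultiClauseSet → Set ℓ
  G ≤ᶠ F = ∀ C → mult G C ≤ mult F C

  -- Duplicate-free.
  var : MultiClauseSet → List Var
  var F = deduplicate _≟ᵛ_ (concatMap vars (support F))

  n : MultiClauseSet → ℕ
  n F = length (var F)

  c : MultiClauseSet → ℕ
  c F = sum (map (mult F) (support F))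

  δ : MultiClauseSet → ℤ
  δ F = + c F - + n F

  touches? : (V : List Var) (C : Clause) → Dec (Any (_∈ V) (vars C))
  touches? V C = any? (_∈? V) (vars C)

  -- ∑_{C : var(C) ∩ V ≠ ∅} F(C) − |V|, for V without repetitions.
  surplusAt : MultiClauseSet → List Var → ℤ
  surplusAt F V = + sum (map (mult F) (filter (touches? V) (support F))) - + length V

  minSurplus : MultiClauseSet → List Var → ℤ
  minSurplus F []        = + 0
  -- The seed is the value at V itself, which is one of the candidates.
  minSurplus F V@(_ ∷ _) = Extremaℤ.min (surplusAt F V) (map (surplusAt F) (nonemptySublists V))

  σ : MultiClauseSet → ℤ
  σ F = minSurplus F (var F)

  infixl 6 _∖_
  _∖_ : List Var → Var → List Var
  V ∖ v = filter (λ w → ¬? (w ≟ᵛ v)) V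

  infixl 7 _↾_
  _↾_ : MultiClauseSet → List Var → MultiClauseSet
  F ↾ V = record
    { mult             = m
    ; mult-cong        = m-cong
    ; support          = filter within? (support F)
    ; support-unique   = UniqueSetoidₚ.filter⁺ clauseSetoid within? (support-unique F)
    ; support-nonzero  = nonzero
    ; support-complete = complete
    }
    where
    within? : ∀ C → Dec (vars C ⊆ V)
    within? C = vars C ⊆? V

    m : Clause → ℕ
    m C = if does (within? C) then mult F C else 0

    respects : ∀ {C D} → C ≈ D → vars C ⊆ V → vars D ⊆ V
    respects C≈D C⊆V = ⊆-trans (map⁺ varOf (proj₂ C≈D)) C⊆V

    m-cong : ∀ {C D} → C ≈ D → m C ≡ m D
    m-cong {C} {D} C≈D with within? C | within? D
    ... | yes _   | yes _   = mult-cong F C≈D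
    ... | no _    | no _    = refl
    ... | yes C⊆V | no D⊈V  = ⊥-elim (D⊈V (respects {C} {D} C≈D C⊆V))
    ... | no C⊈V  | yes D⊆V = ⊥-elim (C⊈V (respects {D} {C} (proj₂ C≈D , proj₁ C≈D) D⊆V))

    nonzero : ∀ {C} → C ∈ᶜ filter within? (support F) → m C ≢ 0
    nonzero {C} C∈ m≡0
      with SetoidMembershipₚ.∈-filter⁻ clauseSetoid within? (λ {A} {B} → respects {A} {B}) {v = C} {xs = support F} C∈
    ... | C∈F , C⊆V with within? C
    ...   | yes _  = support-nonzero F C∈F m≡0
    ...   | no C⊈V = C⊈V C⊆V

    complete : ∀ {C} → m C ≢ 0 → C ∈ᶜ filter within? (support F)
    complete {C} m≢0 with within? C
    ... | yes C⊆V = SetoidMembershipₚ.∈-filter⁺ clauseSetoid within? (λ {A} {B} → respects {A} {B}) {v = C} (support-complete F m≢0) C⊆V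
    ... | no _    = ⊥-elim (m≢0 refl)

  MatchingSatisfiable : MultiClauseSet → Set ℓ
  MatchingSatisfiable G = ∀ G′ → G′ ≤ᶠ G → δ G′ ℤ.≤ + 0

  -- The multi-clause-set consisting of one copy of the empty clause.
  singleEmptyClause : MultiClauseSet
  singleEmptyClause = record
    { mult             = λ C → one (literals C)
    ; mult-cong        = λ {C} {D} (p , q) → one-cong (literals C) (literals D) p q
    ; support          = [ ∅ ]
    ; support-unique   = [] ∷ []
    ; support-nonzero  = λ { {C} (here (C⊆∅ , _)) → nonzero (literals C) C⊆∅ }
    ; support-complete = λ {C} ≢0 → here (complete (literals C) ≢0 , λ ())
    }
    where
    ∅ : Clause
    ∅ = record { literals = [] ; consistent = λ () }

    one : List Lit → ℕ
    one []      = 1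
    one (_ ∷ _) = 0

    one-cong : ∀ xs ys → xs ⊆ ys → ys ⊆ xs → one xs ≡ one ys
    one-cong []      []      _ _ = refl
    one-cong (_ ∷ _) (_ ∷ _) _ _ = refl
    one-cong []      (_ ∷ _) _ q with () ← q (here refl)
    one-cong (_ ∷ _) []      p _ with () ← p (here refl)

    nonzero : ∀ xs → xs ⊆ [] → one xs ≢ 0
    nonzero []      _ ()
    nonzero (_ ∷ _) p _ with () ← p (here refl)

    complete : ∀ xs → one xs ≢ 0 → xs ⊆ []
    complete []      _  ()
    complete (_ ∷ _) ≢0 = ⊥-elim (≢0 refl)

  -- Why a side condition on F without variables is needed: if F consists of
  -- m > 0 copies of the empty clause, then σ(F) = 0 and δ(F) = m, while the
  -- condition ranging over v ∈ var(F) = ∅ holds vacuously.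
  unrestricted-fails :
    ¬ (∀ F → (σ F ≡ δ F) ⇔ (∀ v → v ∈ var F → MatchingSatisfiable (F ↾ (var F ∖ v))))
  unrestricted-fails h with () ← Equivalence.from (h singleEmptyClause) (λ _ ())

{-# OPTIONS --safe #-}

-- If V and W partition var(F), then a clause of F avoids V exactly when its
-- variables lie in W, so the surplus at V satisfies
--   δ(F) = surplusAt F V + (c(F^W) − |W|).
-- Hence σ(F) = δ(F) iff c(F^W) ≤ |W| for every proper subset W of var(F).
-- For G′ ≤ F^{var(F)∖{v}} this is applied with W = var(F) ∩ var(G′), as G′ ≤ F^W;
-- conversely, if v ∉ W then F^W is itself a G′ ≤ F^{var(F)∖{v}}.
module Submission where

open import Defs
open import Level using (Level)
open import Data.List.Membership.Propositional using (_∈_)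
open import Function using (_⇔_; mk⇔; _∘_; _∘′_)
open import Relation.Binary.PropositionalEquality
  using (_≡_; _≢_; refl; sym; trans; cong; cong₂; subst; setoid; module ≡-Reasoning)

open import Data.Bool using (if_then_else_)
open import Data.Empty using (⊥-elim)
open import Data.Integer using (ℤ; +_; _-_; +≤+)
import Data.Integer as ℤ
import Data.Integer.Properties as ℤₚ
open import Data.Integer.Tactic.RingSolver using (solve-∀)
open import Data.List using (List; []; _∷_; map; filter; concatMap; length; _++_)
import Data.List.Extrema ℤₚ.≤-totalOrder as Extremaℤ
import Data.List.Membership.DecPropositional as DecMembership
import Data.List.Membership.Setoid as SetoidMembership
open import Data.List.Membership.Propositional using (find; lose)
open import Data.List.Membership.Propositional.Properties
  using (∈-map⁺; ∈-map⁻; ∈-++⁺ˡ; ∈-++⁺ʳ; ∈-++⁻; ∈-filter⁺; ∈-filter⁻;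
         ∈-concatMap⁺; ∈-concatMap⁻; ∈-deduplicate⁺; ∈-deduplicate⁻)
open import Data.List.Properties using (filter-none; length-++; partition-defn; ++-identityʳ)
open import Data.List.Relation.Binary.Disjoint.Propositional using (Disjoint)
open import Data.List.Relation.Binary.Permutation.Propositional
  using (_↭_; ↭-refl; ↭-reflexive; ↭-sym; ↭-trans; prep; ↭⇒↭ₛ; ↭ₛ⇒↭)
open import Data.List.Relation.Binary.Permutation.Propositional.Properties
  using (∈-resp-↭; ↭-length; shift)
import Data.List.Relation.Binary.Permutation.Setoid.Properties as ↭ₛ
import Data.List.Relation.Binary.Subset.DecPropositional as DecSubset
open import Data.List.Relation.Binary.Subset.Propositional using (_⊆_)
open import Data.List.Relation.Binary.Subset.Propositional.Properties using () renaming (map⁺ to ⊆-map⁺)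
open import Data.List.Relation.Unary.All as All using (All; []; _∷_)
open import Data.List.Relation.Unary.All.Properties using (¬Any⇒All¬)
open import Data.List.Relation.Unary.AllPairs using ([]; _∷_)
open import Data.List.Relation.Unary.Any as Any using (Any; any?; here; there; _─_)
import Data.List.Relation.Unary.Unique.DecPropositional.Properties as DecUniqueₚ
open import Data.List.Relation.Unary.Unique.Propositional using (Unique)
import Data.List.Relation.Unary.Unique.Propositional.Properties as Uniqueₚ
import Data.List.Relation.Unary.Unique.Setoid as UniqueSetoid
open import Data.Nat as ℕ using (ℕ; _+_; _≤_; z≤n)
open import Data.Nat.ListAction using (sum)
import Data.Nat.Properties as ℕₚ
open import Algebra.Properties.CommutativeSemigroup ℕₚ.+-commutativeSemigroup using (x∙yz≈y∙xz)
open import Data.Product using (_×_; _,_; proj₁; proj₂; ∃-syntax)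
open import Data.Sum using (inj₁; inj₂)
open import Relation.Binary using (Setoid)
open import Relation.Nullary using (¬_; yes; no; does; ¬?)
open import Relation.Unary using (Pred; Decidable)

-- Comparing sums over lists without repetition up to an equivalence.

module _ {a ℓ} (S : Setoid a ℓ) where
  open Setoid S using (Carrier; _≈_) renaming (sym to ≈-sym; trans to ≈-trans)
  open SetoidMembership S using () renaming (_∈_ to _∈ₛ_)
  open UniqueSetoid S using () renaming (Unique to Uniqueₛ)

  ∈-─⁺ : ∀ {x y ys} (p : x ∈ₛ ys) → y ∈ₛ ys → ¬ x ≈ y → y ∈ₛ (ys ─ p)
  ∈-─⁺ (here x≈z) (here y≈z) x≉y = ⊥-elim (x≉y (≈-trans x≈z (≈-sym y≈z)))
  ∈-─⁺ (here _)   (there q)  _   = q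
  ∈-─⁺ (there _)  (here y≈z) _   = here y≈z
  ∈-─⁺ (there p)  (there q)  x≉y = there (∈-─⁺ p q x≉y)

  module _ {f g : Carrier → ℕ} (g-cong : ∀ {x y} → x ≈ y → g x ≡ g y) where

    sum-─ : ∀ {x ys} (p : x ∈ₛ ys) → sum (map g ys) ≡ g x + sum (map g (ys ─ p))
    sum-─ {ys = y ∷ ys} (here x≈y) = cong (_+ sum (map g ys)) (sym (g-cong x≈y))
    sum-─ {x} {y ∷ ys}  (there p)  =
      trans (cong (g y ℕ.+_) (sum-─ p)) (x∙yz≈y∙xz (g y) (g x) _)

    -- Induction on `xs`: the head is paired with an equivalent entry of `ys`, which is then
    -- deleted. The entries of the tail are inequivalent to the head, so their partners survive the
    -- deletion. Entries of `ys` left over at the end only add natural numbers.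
    sum-mono-unique : (∀ x → f x ≤ g x) → ∀ {xs ys} → Uniqueₛ xs →
                      All (_∈ₛ ys) xs → sum (map f xs) ≤ sum (map g ys)
    sum-mono-unique f≤g [] [] = z≤n
    sum-mono-unique f≤g {x ∷ xs} (x∉xs ∷ xs!) (x∈ys ∷ xs⊆ys) =
      ℕₚ.≤-trans
        (ℕₚ.+-mono-≤ (f≤g x) (sum-mono-unique f≤g xs!
          (All.zipWith (λ (x≉y , y∈ys) → ∈-─⁺ x∈ys y∈ys x≉y) (x∉xs , xs⊆ys))))
        (ℕₚ.≤-reflexive (sym (sum-─ x∈ys)))

-- Splitting lists, and nonempty sublists with their complements.

module _ {a} {A : Set a} where

  length≡sum : (xs : List A) → length xs ≡ sum (map (λ _ → 1) xs)
  length≡sum []       = refl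
  length≡sum (_ ∷ xs) = cong ℕ.suc (length≡sum xs)

  -- The pigeonhole principle, as the case of constant weight 1 in `sum-mono-unique`.
  length-mono-unique : {xs ys : List A} → Unique xs → xs ⊆ ys → length xs ≤ length ys
  length-mono-unique {xs} {ys} xs! xs⊆ys
    rewrite length≡sum xs | length≡sum ys
    = sum-mono-unique (setoid A) (λ _ → refl) (λ _ → ℕₚ.≤-refl) xs! (All.tabulate xs⊆ys)

  unique-++⇒disjoint : {xs ys : List A} → Unique (xs ++ ys) → Disjoint xs ys
  unique-++⇒disjoint {_ ∷ xs} (x∉ ∷ _)   (here refl , z∈ys) = All.lookup x∉ (∈-++⁺ʳ xs z∈ys) refl
  unique-++⇒disjoint {_ ∷ _}  (_ ∷ xsys!) (there z∈xs , z∈ys) = unique-++⇒disjoint xsys! (z∈xs , z∈ys)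

  unique-resp-↭ : {xs ys : List A} → xs ↭ ys → Unique xs → Unique ys
  unique-resp-↭ xs↭ys = ↭ₛ.Unique-resp-↭ (setoid A) (↭⇒↭ₛ xs↭ys)

  -- The conditional weight is the one built into `mult (F ↾ W)`, so that for clauses inside `W` the
  -- second sum is `c (F ↾ W)` by definition. The two conditions are confined to entries of `xs`
  -- because the covering one is derived from membership in the support.
  sum-partition : ∀ {p q} {P : Pred A p} {Q : Pred A q} (P? : Decidable P) (Q? : Decidable Q)
    (f : A → ℕ) {xs : List A} → All (λ x → ¬ P x → Q x) xs → All (λ x → P x → ¬ Q x) xs →
    sum (map f xs) ≡
      sum (map f (filter P? xs)) + sum (map (λ x → if does (Q? x) then f x else 0) (filter Q? xs))
  sum-partition P? Q? f [] [] = refl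
  sum-partition P? Q? f {x ∷ xs} (¬p⇒q ∷ cover) (p⇒¬q ∷ disj)
    with sum-partition P? Q? f cover disj | P? x | Q? x in eq
  ... | _  | yes p | yes q = ⊥-elim (p⇒¬q p q)
  ... | _  | no ¬p | no ¬q = ⊥-elim (¬q (¬p⇒q ¬p))
  ... | ih | yes _ | no _  = trans (cong (f x ℕ.+_) ih) (sym (ℕₚ.+-assoc (f x) _ _))
  -- The conditional at `x` appears only after `filter` has unfolded, so it escapes the `with`
  -- abstraction and is resolved by `eq`.
  ... | ih | no _  | yes _ rewrite eq =
    trans (cong (f x ℕ.+_) ih) (x∙yz≈y∙xz (f x) (sum (map f (filter P? xs))) _)

  ↭-filter-++ : ∀ {p} {P : Pred A p} (P? : Decidable P) (xs : List A) →
                xs ↭ filter P? xs ++ filter (¬? ∘ P?) xs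
  ↭-filter-++ P? xs = ↭-trans (↭ₛ⇒↭ (↭ₛ.partition-↭ (setoid A) P? xs))
    (↭-reflexive (cong (λ (ys , zs) → ys ++ zs) (partition-defn P? xs)))

  self∈nonemptySublists : ∀ (x : A) xs → x ∷ xs ∈ nonemptySublists (x ∷ xs)
  self∈nonemptySublists x []       = here refl
  self∈nonemptySublists x (y ∷ xs) = there (∈-++⁺ˡ (∈-map⁺ (x ∷_) (self∈nonemptySublists y xs)))

  filter∈nonemptySublists : ∀ {p} {P : Pred A p} (P? : Decidable P) {xs : List A} →
                            Any P xs → filter P? xs ∈ nonemptySublists xs
  filter∈nonemptySublists P? {x ∷ xs} p with P? x
  filter∈nonemptySublists P? {x ∷ xs} p | yes _ with any? P? xs
  ... | yes q = there (∈-++⁺ˡ (∈-map⁺ (x ∷_) (filter∈nonemptySublists P? q)))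
  -- The filter keeps nothing of the tail, so the result is the singleton that is listed first.
  ... | no ¬q = here (cong (x ∷_) (filter-none P? (¬Any⇒All¬ xs ¬q)))
  filter∈nonemptySublists P? {x ∷ xs} (here px) | no ¬px = ⊥-elim (¬px px)
  filter∈nonemptySublists P? {x ∷ xs} (there p) | no _   =
    there (∈-++⁺ʳ (map (x ∷_) (nonemptySublists xs)) (filter∈nonemptySublists P? p))

  -- Turns a candidate in the minimum defining `σ` into a partition of the variables, together with
  -- a variable `v` to be removed.
  nonemptySublists-split : ∀ {ys : List A} xs → ys ∈ nonemptySublists xs →
    (∃[ y ] y ∈ ys) × (∃[ zs ] xs ↭ ys ++ zs)
  nonemptySublists-split (x ∷ xs) (here refl) = (x , here refl) , xs , ↭-refl
  nonemptySublists-split (x ∷ xs) (there ys∈) with ∈-++⁻ (map (x ∷_) (nonemptySublists xs)) ys∈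
  ... | inj₁ q with _ , q′ , refl ← ∈-map⁻ (x ∷_) q
               with _ , zs , xs↭ ← nonemptySublists-split xs q′
    = (x , here refl) , zs , prep x xs↭
  ... | inj₂ q with y∈ys , zs , xs↭ ← nonemptySublists-split xs q
    = y∈ys , x ∷ zs , ↭-trans (prep x xs↭) (↭-sym (shift x _ zs))

-- Integer inequalities for comparing deficiencies.

i+j≤i⇒j≤0 : ∀ i {j} → i ℤ.+ j ℤ.≤ i → j ℤ.≤ + 0
i+j≤i⇒j≤0 i {j} p = subst (ℤ._≤ + 0) (i+j-i≡j i j) (ℤₚ.i≤j⇒i-j≤0 p)
  where
  i+j-i≡j : ∀ i j → i ℤ.+ j - i ≡ j
  i+j-i≡j = solve-∀

j≤0⇒i+j≤i : ∀ i {j} → j ℤ.≤ + 0 → i ℤ.+ j ℤ.≤ i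
j≤0⇒i+j≤i i {j} p = subst (i ℤ.+ j ℤ.≤_) (ℤₚ.+-identityʳ i) (ℤₚ.+-monoʳ-≤ i p)

difference-mono : ∀ {k l m n} → k ≤ l → n ≤ m → + k - + m ℤ.≤ + l - + n
difference-mono k≤l n≤m = ℤₚ.+-mono-≤ (+≤+ k≤l) (ℤₚ.neg-mono-≤ (+≤+ n≤m))

-- Restriction, minimal surplus and the splitting of the deficiency.

module _ {ℓ : Level} (L : Literals ℓ) where
  open ClauseSets L
  open DecMembership _≟ᵛ_ using (_∈?_)
  open DecSubset _≟ᵛ_ using (_⊆?_)
  open SetoidMembership clauseSetoid using () renaming (_∈_ to _∈ᶜ_)

  var-unique : ∀ F → Unique (var F)
  var-unique F = DecUniqueₚ.deduplicate-! _≟ᵛ_ (concatMap vars (support F))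

  support⇒vars⊆var : ∀ F {C} → C ∈ᶜ support F → vars C ⊆ var F
  support⇒vars⊆var F C∈ x∈C with D , D∈ , C≈D ← find C∈ =
    ∈-deduplicate⁺ _≟ᵛ_ (∈-concatMap⁺ vars (lose D∈ (⊆-map⁺ varOf (proj₁ C≈D) x∈C)))

  var-↾-⊆ : ∀ F W → var (F ↾ W) ⊆ W
  var-↾-⊆ F W x∈
    with C , C∈ , x∈C ← find (∈-concatMap⁻ vars (∈-deduplicate⁻ _≟ᵛ_ (concatMap vars (support (F ↾ W))) x∈))
    = proj₂ (∈-filter⁻ (λ C → vars C ⊆? W) {xs = support F} C∈) x∈C

  -- The supports may contain different representatives of the same clause, hence the comparison up
  -- to `_≈_`.
  c-mono : ∀ {G H} → G ≤ᶠ H → c G ≤ c H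
  c-mono {G} {H} G≤H = sum-mono-unique clauseSetoid (mult-cong H) G≤H (support-unique G)
    (All.tabulateₛ clauseSetoid λ {C} C∈ →
      support-complete H λ H≡0 → support-nonzero G C∈ (ℕₚ.n≤0⇒n≡0 (subst (mult G C ≤_) H≡0 (G≤H C))))

  ↾-≤ : ∀ F W → F ↾ W ≤ᶠ F
  ↾-≤ F W C with vars C ⊆? W
  ... | yes _ = ℕₚ.≤-refl
  ... | no _  = z≤n

  ≤-↾ : ∀ {G F W} → G ≤ᶠ F → (∀ {C} → mult G C ≢ 0 → vars C ⊆ W) → G ≤ᶠ F ↾ W
  ≤-↾ {G} {F} {W} G≤F G⊆W C with vars C ⊆? W
  ... | yes _ = G≤F C
  ... | no C⊈W with mult G C ℕ.≟ 0
  ...   | yes G≡0 = ℕₚ.≤-reflexive G≡0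
  ...   | no G≢0  = ⊥-elim (C⊈W (G⊆W G≢0))

  minSurplus-≤ : ∀ F U {V} → V ∈ nonemptySublists U → minSurplus F U ℤ.≤ surplusAt F V
  minSurplus-≤ F U@(_ ∷ _) V∈ =
    All.lookup (Extremaℤ.min≤xs (surplusAt F U) (map (surplusAt F) (nonemptySublists U)))
               (∈-map⁺ (surplusAt F) V∈)

  minSurplus-greatest : ∀ F {d} x U → (∀ {V} → V ∈ nonemptySublists (x ∷ U) → d ℤ.≤ surplusAt F V) →
                        d ℤ.≤ minSurplus F (x ∷ U)
  -- The seed of the minimum is the surplus at the whole list, so `lb` bounds it too.
  minSurplus-greatest F {d} x U lb = Extremaℤ.v≤min⁺ (lb (self∈nonemptySublists x U))
    (All.tabulate λ s∈ → let V , V∈ , eq = ∈-map⁻ (surplusAt F) s∈ in subst (d ℤ.≤_) (sym eq) (lb V∈))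

  -- The permutation encodes the partition: the lengths add up, and `V` and `W` are disjoint because
  -- `var F` has no repetitions. Hence each clause of the support is counted in exactly one of the
  -- two sums.
  deficiency-split : ∀ F V W → var F ↭ V ++ W →
                     δ F ≡ surplusAt F V ℤ.+ (+ c (F ↾ W) - + length W)
  deficiency-split F V W N↭ = begin
    + c F - + n F                         ≡⟨ cong₂ (λ i j → + i - + j) c≡ n≡ ⟩
    + (t + k) - + (length V + length W)   ≡⟨ cong₂ _-_ (ℤₚ.pos-+ t k) (ℤₚ.pos-+ (length V) (length W)) ⟩
    + t ℤ.+ + k - (+ length V ℤ.+ + length W) ≡⟨ rearrange (+ t) (+ k) (+ length V) (+ length W) ⟩
    (+ t - + length V) ℤ.+ (+ k - + length W) ∎
    where
    open ≡-Reasoning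
    t k : ℕ
    t = sum (map (mult F) (filter (touches? V) (support F)))
    k = c (F ↾ W)

    rearrange : ∀ t k v w → t ℤ.+ k - (v ℤ.+ w) ≡ (t - v) ℤ.+ (k - w)
    rearrange = solve-∀

    n≡ : n F ≡ length V + length W
    n≡ = trans (↭-length N↭) (length-++ V)

    cover : ∀ {C} → C ∈ᶜ support F → ¬ Any (_∈ V) (vars C) → vars C ⊆ W
    cover {C} C∈ untouched x∈C with ∈-++⁻ V (∈-resp-↭ N↭ (support⇒vars⊆var F {C} C∈ x∈C))
    ... | inj₁ x∈V = ⊥-elim (untouched (lose x∈C x∈V))
    ... | inj₂ x∈W = x∈W

    disjoint : ∀ {C} → Any (_∈ V) (vars C) → ¬ vars C ⊆ W
    disjoint touched C⊆W with x , x∈C , x∈V ← find touched =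
      unique-++⇒disjoint (unique-resp-↭ N↭ (var-unique F)) (x∈V , C⊆W x∈C)

    c≡ : c F ≡ t + k
    c≡ = sum-partition (touches? V) (λ C → vars C ⊆? W) (mult F)
           (All.tabulateₛ clauseSetoid (λ {C} → cover {C})) (All.universal (λ C → disjoint {C}) (support F))

  -- The inequalities between `σ` and `δ`, and matching-satisfiability.

  module _ (F : MultiClauseSet) where

    -- At the candidate `V = var F` the surplus falls short of `δ F` by `c (F ↾ [])`, the number of
    -- copies of the empty clause, which is nonnegative.
    σ≤δ : (n F ≡ 0 → c F ≡ 0) → σ F ℤ.≤ δ F
    σ≤δ nonvoid with var F in eq
    -- Here `σ F` is 0 by convention and `δ F` is `c F`, which the side condition makes 0.
    ... | [] = ℤₚ.≤-reflexive (sym (cong (λ i → + i - + 0) (nonvoid refl)))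
    ... | x ∷ U = begin
      minSurplus F (x ∷ U)                         ≤⟨ minSurplus-≤ F (x ∷ U) (self∈nonemptySublists x U) ⟩
      surplusAt F (x ∷ U)                          ≤⟨ ℤₚ.i≤i+j (surplusAt F (x ∷ U)) _ ⟩
      surplusAt F (x ∷ U) ℤ.+ + c (F ↾ [])         ≡⟨ cong (λ i → surplusAt F (x ∷ U) ℤ.+ i) (ℤₚ.+-identityʳ _) ⟨
      surplusAt F (x ∷ U) ℤ.+ (+ c (F ↾ []) - + 0) ≡⟨ deficiency-split F (x ∷ U) [] split ⟨
      + c F - + n F                                ≡⟨ cong (λ N → + c F - + length N) eq ⟩
      + c F - + length (x ∷ U)                     ∎
      where
      open ℤₚ.≤-Reasoning
      split : var F ↭ (x ∷ U) ++ []
      split = ↭-reflexive (trans eq (sym (++-identityʳ (x ∷ U))))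

    -- `V` collects the variables of `F` missing from `G`; it contains `v`, so it is a candidate,
    -- and the splitting gives that `c (F ↾ W)` is at most the length of `W`. Passing from there to
    -- `G` can only lower the clause count and raise the variable count.
    δ≤surplus⇒satisfiable : (∀ {V} → V ∈ nonemptySublists (var F) → δ F ℤ.≤ surplusAt F V) →
      ∀ {v} → v ∈ var F → MatchingSatisfiable (F ↾ (var F ∖ v))
    δ≤surplus⇒satisfiable δ≤ {v} v∈N G G≤ = ℤₚ.≤-trans
      (difference-mono (c-mono {G} {F ↾ W} G≤F↾W)
        (length-mono-unique (Uniqueₚ.filter⁺ (¬? ∘ new?) (var-unique F)) W⊆varG))
      (i+j≤i⇒j≤0 (surplusAt F V)
        (subst (ℤ._≤ surplusAt F V) (deficiency-split F V W (↭-filter-++ new? (var F)))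
          (δ≤ (filter∈nonemptySublists new? (lose v∈N v∉varG)))))
      where
      new? : Decidable (λ x → ¬ x ∈ var G)
      new? x = ¬? (x ∈? var G)

      V W : List Var
      V = filter new? (var F)
      W = filter (¬? ∘ new?) (var F)

      -- `W` is filtered by a double negation, to be the literal complement of `V`; decidability
      -- removes it.
      W⊆varG : W ⊆ var G
      W⊆varG {x} x∈W with x ∈? var G
      ... | yes x∈ = x∈
      ... | no x∉  = ⊥-elim (proj₂ (∈-filter⁻ (¬? ∘ new?) {xs = var F} x∈W) x∉)

      G≤F : G ≤ᶠ F
      G≤F C = ℕₚ.≤-trans (G≤ C) (↾-≤ F (var F ∖ v) C)

      v∉varG : ¬ v ∈ var G
      v∉varG v∈
        with C , C∈ , v∈C ← find (∈-concatMap⁻ vars (∈-deduplicate⁻ _≟ᵛ_ (concatMap vars (support G)) v∈))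
        with vars C ⊆? (var F ∖ v) | G≤ C
      ... | yes C⊆ | _ = proj₂ (∈-filter⁻ (λ w → ¬? (w ≟ᵛ v)) {xs = var F} (C⊆ v∈C)) refl
      -- A clause not confined to `var F ∖ v` has multiplicity 0 in the restriction, hence in `G`,
      -- although it lies in the support of `G`.
      ... | no _ | G≤0 = support-nonzero G (Any.map (λ { refl → Setoid.refl clauseSetoid {C} }) C∈) (ℕₚ.n≤0⇒n≡0 G≤0)

      G≤F↾W : G ≤ᶠ F ↾ W
      G≤F↾W = ≤-↾ {G} {F} G≤F λ {C} G≢0 x∈C →
        ∈-filter⁺ (¬? ∘ new?)
          (support⇒vars⊆var F {C} (support-complete F λ F≡0 →
            G≢0 (ℕₚ.n≤0⇒n≡0 (subst (mult G C ≤_) F≡0 (G≤F C)))) x∈C)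
          (λ x∉ → x∉ (support⇒vars⊆var G {C} (support-complete G G≢0) x∈C))

    -- For any `v` in `V`, the set `F ↾ W` is a test case for the condition at `v`. Some variables
    -- of `W` may occur in no clause of `F ↾ W`, so subtracting the length of `W` gives at most
    -- `δ (F ↾ W)`, which is at most 0.
    satisfiable⇒δ≤surplus : (∀ v → v ∈ var F → MatchingSatisfiable (F ↾ (var F ∖ v))) →
      ∀ {V} → V ∈ nonemptySublists (var F) → δ F ℤ.≤ surplusAt F V
    satisfiable⇒δ≤surplus sat {V} V∈ with (v , v∈V) , W , N↭ ← nonemptySublists-split (var F) V∈ =
      subst (ℤ._≤ surplusAt F V) (sym (deficiency-split F V W N↭))
        (j≤0⇒i+j≤i (surplusAt F V) (ℤₚ.≤-trans
          (difference-mono ℕₚ.≤-refl (length-mono-unique (var-unique (F ↾ W)) (var-↾-⊆ F W)))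
          (sat v (∈-resp-↭ (↭-sym N↭) (∈-++⁺ˡ v∈V)) (F ↾ W) F↾W≤)))
      where
      W⊆N∖v : W ⊆ var F ∖ v
      W⊆N∖v x∈W = ∈-filter⁺ (λ w → ¬? (w ≟ᵛ v)) (∈-resp-↭ (↭-sym N↭) (∈-++⁺ʳ V x∈W))
        λ { refl → unique-++⇒disjoint (unique-resp-↭ N↭ (var-unique F)) (v∈V , x∈W) }

      F↾W≤ : F ↾ W ≤ᶠ F ↾ (var F ∖ v)
      F↾W≤ = ≤-↾ {F ↾ W} {F} (↾-≤ F W) λ {C} → inside {C}
        where
        inside : ∀ {C} → mult (F ↾ W) C ≢ 0 → vars C ⊆ var F ∖ v
        inside {C} ≢0 with vars C ⊆? W
        ... | yes C⊆W = W⊆N∖v ∘′ C⊆W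
        ... | no _    = ⊥-elim (≢0 refl)

    δ≤σ : (n F ≡ 0 → c F ≡ 0) → (∀ {V} → V ∈ nonemptySublists (var F) → δ F ℤ.≤ surplusAt F V) →
          δ F ℤ.≤ σ F
    δ≤σ nonvoid δ≤ with var F
    ... | []    = ℤₚ.≤-reflexive (cong (λ i → + i - + 0) (nonvoid refl))
    ... | x ∷ U = minSurplus-greatest F x U δ≤

theorem9p5 : ∀ {ℓ : Level} (L : Literals ℓ) → let open ClauseSets L in
    (F : MultiClauseSet) → (n F ≡ 0 → c F ≡ 0) →
    (σ F ≡ δ F) ⇔ (∀ v → v ∈ var F → MatchingSatisfiable (F ↾ (var F ∖ v)))
theorem9p5 L F nonvoid = mk⇔
  (λ σ≡δ v → δ≤surplus⇒satisfiable L F (λ {V} V∈ →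
    subst (ℤ._≤ surplusAt F V) σ≡δ (minSurplus-≤ L F (var F) V∈)))
  -- The side condition yields `σ F ≤ δ F`; satisfiability enters through the reverse inequality.
  (λ sat → ℤₚ.≤-antisym (σ≤δ L F nonvoid) (δ≤σ L F nonvoid (satisfiable⇒δ≤surplus L F sat)))
  where open ClauseSets L
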